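{- For every integer $k$ with $7\le k\le 17$, the Tuza constant satisfies $c_k \ge \dfrac{3}{2k+6}$.
   Context: A hypergraph $H=(V,E)$ consists of a finite vertex set $V$ and a finite collection $E$ of subsets of $V$ (edges). $H$ is $k$-uniform if every edge has exactly $k$ vertices. A transversal of $H$ is a set $T\subseteq V$ meeting every edge; $\tau(H)$ denotes the minimum size of a transversal. For $k\ge 1$, the Tuza constant is $c_k=\sup_{H} \tau(H)/(m+n)$, where the supremum ranges over all $k$-uniform hypergraphs $H$, with $n=|V|$ and $m=|E|$. -}

module Defs where

open import Data.Integer using (+_)
open import Data.Fin.Subset using (Subset; Nonempty; _∩_; ∣_∣)
open import Data.List using (List; length)
open import Data.List.Relation.Unary.All using (All)
open import Data.List.Relation.Unary.Unique.Propositional using (Unique)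
open import Data.Nat as ℕ using (ℕ; NonZero)
open import Data.Product using (_×_; _,_; ∃-syntax)
open import Data.Rational using (ℚ; _/_; _<_)
open import Data.Rational.Properties using (<-trans; <-dense)
open import Relation.Binary.PropositionalEquality using (_≡_)

record Hypergraph : Set where
  field
    n      : ℕ
    edges  : List (Subset n)
    unique : Unique edges

  m : ℕ
  m = length edges

open Hypergraph

Uniform : ℕ → Hypergraph → Set
Uniform k H = All (λ e → ∣ e ∣ ≡ k) (edges H)

Transversal : (H : Hypergraph) → Subset (n H) → Set
Transversal H T = All (λ e → Nonempty (T ∩ e)) (edges H)

-- The graph of τ, which is a partial function: a hypergraph with an empty
-- edge has no transversal.
IsTransversalNumber : Hypergraph → ℕ → Set
IsTransversalNumber H t =
  (∃[ T ] Transversal H T × ∣ T ∣ ≡ t) ×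
  (∀ T → Transversal H T → t ℕ.≤ ∣ T ∣)

-- A supremum of rationals is in general only a real number. It is represented
-- by its open lower cut; below x q is read "q < x". The cut may be empty (-∞)
-- or all of ℚ (+∞).
record LowerReal : Set₁ where
  field
    below   : ℚ → Set
    down    : ∀ {p q} → p < q → below q → below p
    rounded : ∀ {p} → below p → ∃[ q ] p < q × below q

open LowerReal

_≥ᴸ_ : LowerReal → LowerReal → Set
x ≥ᴸ y = ∀ q → below y q → below x q

fromℚ : ℚ → LowerReal
fromℚ r = record
  { below   = λ q → q < r
  ; down    = <-trans
  ; rounded = λ p<r → let q , p<q , q<r = <-dense p<r in q , p<q , q<r
  }

sup : (ℚ → Set) → LowerReal
sup S = record
  { below   = λ q → ∃[ r ] S r × q < r
  ; down    = λ { p<q (r , Sr , q<r) → r , Sr , <-trans p<q q<r }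
  ; rounded = λ { (r , Sr , p<r) →
      let q , p<q , q<r = <-dense p<r in q , p<q , r , Sr , q<r }
  }

-- NonZero excludes only the hypergraph with no vertices and no edges, whose
-- ratio would be 0/0.
data TuzaRatio (k : ℕ) : ℚ → Set where
  ratio : (H : Hypergraph) → Uniform k H →
          ∀ {t} → IsTransversalNumber H t →
          .{{_ : NonZero (m H ℕ.+ n H)}} →
          TuzaRatio k (+ t / (m H ℕ.+ n H))

tuzaConstant : ℕ → LowerReal
tuzaConstant k = sup (TuzaRatio k)

{-# OPTIONS --safe #-}
module Submission where

open import Data.Bool using (_≟_)
open import Data.Empty using (⊥-elim)
open import Data.Fin using (Fin; zero; suc; toℕ)
open import Data.Fin.Properties using (all?; any?)
open import Data.Fin.Subset
  using (Subset; inside; outside; Nonempty; _∈_; ∁; _∪_; _∩_; ⊥; ⊤; ⁅_⁆; ∣_∣)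
open import Data.Fin.Subset.Properties
  using (_∈?_; ∉⊥; nonempty?; x∈p∩q⁻; x∈∁p⇒x∉p)
open import Data.Integer using (+_)
import Data.List as List
open import Data.List.Relation.Unary.All using (All)
import Data.List.Relation.Unary.All as All
import Data.List.Relation.Unary.All.Properties as All
open import Data.List.Relation.Unary.Unique.Propositional using (Unique)
import Data.List.Relation.Unary.Unique.DecPropositional as DecUnique
open import Data.Nat using (ℕ; zero; suc; s≤s; s≤s⁻¹; _≤_; _<_; _+_; _*_; pred; _≤?_)
import Data.Nat as ℕ
open import Data.Nat.DivMod using (_mod_)
open import Data.Nat.Properties using (allUpTo?; ≮⇒≥)
open import Data.Product using (_×_; _,_; ∃-syntax)
open import Data.Rational using (_/_)
open import Data.Vec using (Vec; []; _∷_; here; there; lookup; replicate; tabulate)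
import Data.Vec.Membership.Propositional as Vec
open import Data.Vec.Properties using (≡-dec; lookup∘tabulate; []=⇒lookup; lookup⇒[]=)
import Data.Vec.Relation.Unary.Any as Any
open import Function using (_∘_)
open import Relation.Binary.PropositionalEquality using (_≡_; refl; sym; trans)
open import Relation.Nullary using (Dec; ¬_)
open import Relation.Nullary.Decidable using (from-yes; _×-dec_; _→-dec_)
open import Defs

-- Any two points of the Fano plane lie on a common line, so no two vertices
-- meet the complements of all seven lines. Blow the points up to classes of
-- vertices, as evenly as possible and 2k - 1 vertices in total: each complement
-- then has at least k vertices, and shrinking it to k of them creates no new
-- transversals. Hence τ = 3 with m + n = 7 + (2k - 1) = 2k + 6.

-- The translates of the perfect difference set {0,1,3} modulo 7.
line : Fin 7 → Subset 7
line i = ⁅ i ⁆ ∪ ⁅ (1 + toℕ i) mod 7 ⁆ ∪ ⁅ (3 + toℕ i) mod 7 ⁆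

-- Settled by checking all 49 pairs; `c ≡ d` is among them because two vertices may share a class.
line-through : ∀ c d → ∃[ i ] c ∈ line i × d ∈ line i
line-through = from-yes (all? λ c → all? λ d → any? λ i →
  (c ∈? line i) ×-dec (d ∈? line i))

-- The elements kept are the first ones. So an edge retains its least candidate, which is vertex 0,
-- 1 or 2 as no line contains all three points.
truncate : ∀ {n} → ℕ → Subset n → Subset n
truncate zero    p             = ⊥
truncate (suc k) []            = []
truncate (suc k) (inside  ∷ p) = inside  ∷ truncate k p
truncate (suc k) (outside ∷ p) = outside ∷ truncate (suc k) p

truncate⊆ : ∀ {n} k (p : Subset n) {x} → x ∈ truncate k p → x ∈ p
truncate⊆ zero    p             x∈         = ⊥-elim (∉⊥ x∈)
truncate⊆ (suc k) (inside  ∷ p) here       = here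
truncate⊆ (suc k) (inside  ∷ p) (there x∈) = there (truncate⊆ k p x∈)
truncate⊆ (suc k) (outside ∷ p) (there x∈) = there (truncate⊆ (suc k) p x∈)

preimage : ∀ {m n} → (Fin m → Fin n) → Subset n → Subset m
preimage f p = tabulate (lookup p ∘ f)

∈-preimage⁻ : ∀ {m n} (f : Fin m → Fin n) p {x} → x ∈ preimage f p → f x ∈ p
∈-preimage⁻ f p {x} x∈ = lookup⇒[]= (f x) p
  (trans (sym (lookup∘tabulate (lookup p ∘ f) x)) ([]=⇒lookup x∈))

-- The default value a pads the enumeration when ∣ p ∣ < s.
enumerate-image : ∀ {A : Set} → A → ∀ {n s} (f : Fin n → A) (p : Subset n) →
  ∣ p ∣ ≤ s → ∃[ v ] (∀ {x} → x ∈ p → Vec._∈_ (f x) {s} v)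
enumerate-image a f [] _ = replicate _ a , λ ()
enumerate-image a f (outside ∷ p) ∣p∣≤s =
  let v , fp⊆v = enumerate-image a (f ∘ suc) p ∣p∣≤s
  in v , λ { (there x∈p) → fp⊆v x∈p }
enumerate-image a f (inside ∷ p) (s≤s ∣p∣≤s) =
  let v , fp⊆v = enumerate-image a (f ∘ suc) p ∣p∣≤s
  in f zero ∷ v , λ { here → Any.here refl ; (there x∈p) → Any.there (fp⊆v x∈p) }

order : ℕ → ℕ
order k = pred (2 * k)

-- Residues modulo 7 give classes whose sizes differ by at most one.
point : ∀ {n} → Fin n → Fin 7
point x = toℕ x mod 7

edge : ∀ k → Fin 7 → Subset (order k)
edge k i = truncate k (preimage point (∁ (line i)))

blowup-edges : ∀ k → List.List (Subset (order k))
blowup-edges k = List.tabulate (edge k)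

edge-avoids-line : ∀ k i {x} → x ∈ edge k i → ¬ point x ∈ line i
edge-avoids-line k i x∈ =
  x∈∁p⇒x∉p (∈-preimage⁻ point (∁ (line i)) (truncate⊆ k _ x∈))

-- Two vertices of `T` have their points on some line `i`, and `edge k i` has no vertex over that
-- line. Truncation only shrinks edges, so this works for every `k`.
transversal≥3 : ∀ k (T : Subset (order k)) →
  All (λ e → Nonempty (T ∩ e)) (blowup-edges k) → 3 ≤ ∣ T ∣
-- If `T` has fewer than two vertices, the point `zero` pads the pair; any point would do.
transversal≥3 k T meets = ≮⇒≥ λ ∣T∣<3 → avoided (enumerate-image zero point T (s≤s⁻¹ ∣T∣<3))
  where
  avoided : ¬ (∃[ v ] (∀ {x} → x ∈ T → Vec._∈_ (point x) {2} v))
  avoided (c ∷ d ∷ [] , T⊆cd) with line-through c d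
  ... | i , c∈i , d∈i with All.tabulate⁻ {f = edge k} meets i
  ... | x , x∈T∩e with x∈p∩q⁻ T (edge k i) x∈T∩e
  ... | x∈T , x∈e with T⊆cd x∈T
  ... | Any.here refl             = edge-avoids-line k i x∈e c∈i
  ... | Any.there (Any.here refl) = edge-avoids-line k i x∈e d∈i

-- The points 0, 1, 2 are not collinear.
smallTransversal : ∀ k → Subset (order k)
smallTransversal k = truncate 3 ⊤

-- The facts that evaluation settles quickly for a given `k`. The lower bound on transversals
-- quantifies over all subsets and is kept out.
Valid : ℕ → Set
Valid k =
  All (λ e → ∣ e ∣ ≡ k) (blowup-edges k) ×
  Unique (blowup-edges k) ×
  All (λ e → Nonempty (smallTransversal k ∩ e)) (blowup-edges k) ×
  ∣ smallTransversal k ∣ ≡ 3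

valid? : ∀ k → Dec (Valid k)
valid? k =
  All.all? (λ e → ∣ e ∣ ℕ.≟ k) (blowup-edges k)
    ×-dec DecUnique.unique? (≡-dec _≟_) (blowup-edges k)
    ×-dec All.all? (λ e → nonempty? (smallTransversal k ∩ e)) (blowup-edges k)
    ×-dec ∣ smallTransversal k ∣ ℕ.≟ 3

-- Uniformity says that over each line there are at most `k - 1` of the `2k - 1` vertices.
valid-range : ∀ {k} → k < 18 → 7 ≤ k → Valid k
valid-range = from-yes (allUpTo? (λ k → (7 ≤? k) →-dec valid? k) 18)

theorem1 : ∀ (k : ℕ) → 7 ≤ k → k ≤ 17 →
    tuzaConstant k ≥ᴸ fromℚ (+ 3 / (6 + 2 * k))
-- Matching on `suc` lets `pred` compute, so that `7 + order k` and `6 + 2 * k` agree by definition.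
theorem1 k@(suc _) 7≤k k≤17 q q<r =
  let uniform , distinct , transversal , size = valid-range (s≤s k≤17) 7≤k
      H = record { n = order k ; edges = blowup-edges k ; unique = distinct }
  in _ , ratio H uniform ((smallTransversal k , transversal , size) , transversal≥3 k) , q<r
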